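{- A simplicial complex $\Delta$ is skeleton-E-chordal if and only if every nonempty induced subcomplex of $\Delta$ has a skeleton-E-simplicial vertex.
   Context: Simplicial complexes are finite and not necessarily pure. A vertex labeling of a complex with $n$ vertices is a bijection of its vertices with $[n]=\{1,\dots,n\}$; $\max f$ is the largest label in a face $f$; the size of a face is its number of vertices. $\Delta$ is skeleton-E-chordal if it has a vertex labeling such that for every two faces $f\neq g$ of $\Delta$ with the same size and the same maximum, every subset $h\subseteq f\cup g$ with $|h|=|f|$ is a face of $\Delta$. A vertex $v$ of a complex $\Gamma$ is skeleton-E-simplicial (in $\Gamma$) if for any two faces $f\ne g$ of $\Gamma$ of the same size that contain $v$, every subset of $f\cup g$ of size $|f|$ is a face of $\Gamma$. A nonempty induced subcomplex is the subcomplex of all faces of $\Delta$ contained in $W$, for some nonempty set $W$ of vertices of $\Delta$. -}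

module Defs where

open import Data.Fin.Base using (Fin; _≤_)
open import Data.Fin.Subset using (Subset; _∈_; _⊆_; _∪_; ⁅_⁆; ∣_∣)
open import Data.Fin.Subset.Properties using (_⊆?_)
open import Data.Nat.Base using (ℕ)
open import Data.Product.Base using (∃; ∃-syntax; _×_; _,_; proj₁)
open import Data.Vec.Base using (tabulate)
open import Data.Vec.Properties using (lookup∘tabulate; []=⇒lookup; lookup⇒[]=)
open import Function.Bundles using (_⇔_; mk⇔; _⤖_; Bijection)
open import Level using (0ℓ)
open import Relation.Binary.PropositionalEquality using (_≡_; _≢_; sym; trans)
open import Relation.Nullary.Decidable using (does; yes; no; dec-true; _×-dec_)
open import Relation.Unary using (Pred; Decidable)

-- Faces are drawn from a finite ground set Fin N, whose elements need not all
-- be vertices: this way an induced subcomplex is again a complex on Fin N.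
-- The face predicate is decidable, i.e. the complex is a finite set of faces.
-- The void complex (not even ∅ is a face) is allowed.

record SimplicialComplex (N : ℕ) : Set₁ where
  field
    Face        : Pred (Subset N) 0ℓ
    Face?       : Decidable Face
    down-closed : ∀ {f g} → f ⊆ g → Face g → Face f

open SimplicialComplex public

private
  variable
    N : ℕ

vertices : SimplicialComplex N → Subset N
vertices Γ = tabulate λ v → does (Face? Γ ⁅ v ⁆)

∈vertices⇔ : (Γ : SimplicialComplex N) {v : Fin N} →
             v ∈ vertices Γ ⇔ Face Γ ⁅ v ⁆
∈vertices⇔ Γ {v} = mk⇔ to from
  where
  eq = lookup∘tabulate (λ v → does (Face? Γ ⁅ v ⁆)) v

  to : v ∈ vertices Γ → Face Γ ⁅ v ⁆
  to v∈ with Face? Γ ⁅ v ⁆ | trans (sym eq) ([]=⇒lookup v∈)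
  ... | yes p | _  = p
  ... | no _  | ()

  from : Face Γ ⁅ v ⁆ → v ∈ vertices Γ
  from p = lookup⇒[]= v _ (trans eq (dec-true (Face? Γ ⁅ v ⁆) p))

-- Membership in a Subset is proof-irrelevant, so equality of vertices is
-- equality of the underlying elements of Fin N.

Vertex : SimplicialComplex N → Set
Vertex Γ = ∃ λ v → v ∈ vertices Γ

-- With n the number of vertices, Fin n plays the role of [n] = {1,…,n};
-- only the order of the labels matters.

Labeling : SimplicialComplex N → Set
Labeling Γ = Vertex Γ ⤖ Fin ∣ vertices Γ ∣

module _ (Γ : SimplicialComplex N) (L : Labeling Γ) where

  open Bijection L using () renaming (to to label)

  IsMaxLabel : Subset N → Fin ∣ vertices Γ ∣ → Set
  IsMaxLabel f m =
    (∃[ v ] proj₁ v ∈ f × label v ≡ m) ×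
    (∀ v → proj₁ v ∈ f → label v ≤ m)

  SameMaximum : Subset N → Subset N → Set
  SameMaximum f g = ∃[ m ] IsMaxLabel f m × IsMaxLabel g m

SkeletonEChordal : SimplicialComplex N → Set
SkeletonEChordal Δ = ∃[ L ] ∀ f g → Face Δ f → Face Δ g →
  f ≢ g → ∣ f ∣ ≡ ∣ g ∣ → SameMaximum Δ L f g →
  ∀ h → h ⊆ f ∪ g → ∣ h ∣ ≡ ∣ f ∣ → Face Δ h

SkeletonESimplicial : (Γ : SimplicialComplex N) → Vertex Γ → Set
SkeletonESimplicial Γ (v , _) = ∀ f g → Face Γ f → Face Γ g →
  f ≢ g → ∣ f ∣ ≡ ∣ g ∣ → v ∈ f → v ∈ g →
  ∀ h → h ⊆ f ∪ g → ∣ h ∣ ≡ ∣ f ∣ → Face Γ h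

induced : SimplicialComplex N → Subset N → SimplicialComplex N
induced Δ W = record
  { Face        = λ f → Face Δ f × f ⊆ W
  ; Face?       = λ f → Face? Δ f ×-dec f ⊆? W
  ; down-closed = λ f⊆g (g∈Δ , g⊆W) →
                    down-closed Δ f⊆g g∈Δ , λ x∈f → g⊆W (f⊆g x∈f)
  }

{-# OPTIONS --safe #-}
-- In a chordal labeling, the vertex of W with the largest label is simplicial in
-- the complex induced on W: it is the maximum of every face containing it.
-- Conversely, give the largest label to a simplicial vertex, remove it and
-- repeat: two faces with the same maximum v contain v and survive until v is
-- removed.
module Submission where

open import Defs
open import Data.Nat.Base using (ℕ)
open import Data.Fin.Subset using (Subset; Nonempty; _⊆_)
open import Data.Product.Base using (∃-syntax)
open import Function.Bundles using (_⇔_)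

open import Data.Fin.Base as Fin using (Fin; zero; suc; toℕ; fromℕ<)
open import Data.Fin.Properties using (_≟_; any?; toℕ<n; toℕ-injective; toℕ-fromℕ<)
open import Data.Fin.Subset
  using (Empty; inside; outside; _∈_; _∪_; _-_; ⁅_⁆; ∣_∣)
open import Data.Fin.Subset.Properties
  using ( _∈?_; nonempty?; Empty-unique; ∣⊥∣≡0; p─⊥≡p; p─q⊆p; x∈⁅x⁆; x∈⁅y⁆⇒x≡y
        ; x∈p∧x≢y⇒x∈p-y; x∈p∪q⁻)
open import Data.Nat.Base using (zero; suc; _≤_; _<_; z≤n; s≤s; s≤s⁻¹)
import Data.Nat.Properties as ℕ
open import Data.Product.Base using (∃; _×_; _,_; proj₁; proj₂)
open import Data.Sum.Base using ([_,_])
open import Data.Vec.Base using (_∷_; here; there)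
open import Data.Vec.Functional using (updateAt)
open import Data.Vec.Functional.Properties using (updateAt-updates; updateAt-minimal)
open import Data.Vec.Properties.WithK using ([]=-irrelevant)
open import Function.Base using (_∘_; const)
open import Function.Bundles using (mk⇔; mk⤖; Equivalence; Bijection)
open import Relation.Binary.PropositionalEquality
  using (_≡_; _≢_; refl; sym; trans; cong; subst; subst₂)
open import Relation.Nullary.Decidable using (yes; no)
open import Relation.Nullary.Negation using (contradiction)
open import Relation.Unary using (Pred; Decidable)

private
  variable
    N : ℕ

maximum : ∀ {n p} {P : Pred (Fin n) p} → Decidable P → ∃ P →
          ∃[ m ] P m × (∀ i → P i → i Fin.≤ m)
-- Any witness of the form `suc j` beats `zero`, so `zero` is the maximum only when there is none.
maximum {suc n} {P = P} P? (i , Pi) with any? (P? ∘ suc)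
... | yes ∃P = let m , Pm , max = maximum (P? ∘ suc) ∃P in
  suc m , Pm , λ { zero _ → z≤n ; (suc j) Pj → s≤s (max j Pj) }
... | no ∄P with i
...   | zero  = zero , Pi , λ { zero _ → z≤n ; (suc j) Pj → contradiction (j , Pj) ∄P }
...   | suc j = contradiction (j , Pi) ∄P

x∈p-y⇒x≢y : ∀ (p : Subset N) {x y} → x ∈ p - y → x ≢ y
x∈p-y⇒x≢y (_ ∷ p) {suc x} (there x∈p-x) refl = x∈p-y⇒x≢y p x∈p-x refl

∣p∣≡1+∣p-x∣ : {p : Subset N} {x : Fin N} → x ∈ p → ∣ p ∣ ≡ suc ∣ p - x ∣
-- Removing the head leaves the tail minus the empty set, which equals the tail only
-- propositionally.
∣p∣≡1+∣p-x∣ {p = inside  ∷ p} here        = cong (suc ∘ ∣_∣) (sym (p─⊥≡p p))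
∣p∣≡1+∣p-x∣ {p = inside  ∷ p} (there x∈p) = cong suc (∣p∣≡1+∣p-x∣ x∈p)
∣p∣≡1+∣p-x∣ {p = outside ∷ p} (there x∈p) = ∣p∣≡1+∣p-x∣ x∈p

∣p∣≡1+k⇒Nonempty : ∀ {k} {p : Subset N} → ∣ p ∣ ≡ suc k → Nonempty p
∣p∣≡1+k⇒Nonempty {N} {p = p} ∣p∣≡1+k with nonempty? p
... | yes ne = ne
... | no  em = contradiction
  (trans (sym (∣⊥∣≡0 N)) (trans (cong ∣_∣ (sym (Empty-unique em))) ∣p∣≡1+k)) λ ()

∣p∣≡0⇒Empty : {p : Subset N} → ∣ p ∣ ≡ 0 → Empty p
∣p∣≡0⇒Empty ∣p∣≡0 (x , x∈p) = contradiction (trans (sym (∣p∣≡1+∣p-x∣ x∈p)) ∣p∣≡0) λ ()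

∪-lub : {f g W : Subset N} → f ⊆ W → g ⊆ W → f ∪ g ⊆ W
∪-lub f⊆W g⊆W x∈f∪g = [ f⊆W , g⊆W ] (x∈p∪q⁻ _ _ x∈f∪g)

module _ (Δ : SimplicialComplex N) where

  Face⇒⊆vertices : ∀ {f} → Face Δ f → f ⊆ vertices Δ
  Face⇒⊆vertices {f} f∈Δ {x} x∈f = Equivalence.from (∈vertices⇔ Δ)
    (down-closed Δ (λ y∈⁅x⁆ → subst (_∈ f) (sym (x∈⁅y⁆⇒x≡y x y∈⁅x⁆)) x∈f) f∈Δ)

  vertices-induced⊆ : ∀ {W} → vertices (induced Δ W) ⊆ W
  vertices-induced⊆ {W} {x} x∈ =
    proj₂ (Equivalence.to (∈vertices⇔ (induced Δ W)) x∈) (x∈⁅x⁆ x)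

  vertices-induced⊇ : ∀ {W} → W ⊆ vertices Δ → W ⊆ vertices (induced Δ W)
  vertices-induced⊇ {W} W⊆V {x} x∈W = Equivalence.from (∈vertices⇔ (induced Δ W))
    ( Equivalence.to (∈vertices⇔ Δ) (W⊆V x∈W)
    , λ y∈⁅x⁆ → subst (_∈ W) (sym (x∈⁅y⁆⇒x≡y x y∈⁅x⁆)) x∈W)

  -- Chordality only puts the new face in `Δ`; it stays in `W` because both given faces do. Labels
  -- live on vertices of `Δ`, so `v` is a vertex there, and `v∈` separately places it in the induced
  -- subcomplex.
  maxLabel-simplicial : ((L , _) : SkeletonEChordal Δ) → ∀ {W} {v : Vertex Δ} →
    (∀ w → proj₁ w ∈ W → Bijection.to L w Fin.≤ Bijection.to L v) →
    (v∈ : proj₁ v ∈ vertices (induced Δ W)) →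
    SkeletonESimplicial (induced Δ W) (proj₁ v , v∈)
  maxLabel-simplicial (L , chordal) {W} {v} max _ f g (f∈Δ , f⊆W) (g∈Δ , g⊆W)
    f≢g ∣f∣≡∣g∣ v∈f v∈g h h⊆ ∣h∣≡∣f∣ =
    chordal f g f∈Δ g∈Δ f≢g ∣f∣≡∣g∣ (label v , isMax f⊆W v∈f , isMax g⊆W v∈g) h h⊆ ∣h∣≡∣f∣ ,
    ∪-lub f⊆W g⊆W ∘ h⊆
    where
    open Bijection L using () renaming (to to label)

    isMax : ∀ {e} → e ⊆ W → proj₁ v ∈ e → IsMaxLabel Δ L e (label v)
    isMax e⊆W v∈e = (v , v∈e , refl) , λ w w∈e → max w (e⊆W w∈e)

  chordal⇒simplicial : SkeletonEChordal Δ → ∀ W → Nonempty W → W ⊆ vertices Δ →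
                       ∃[ v ] SkeletonESimplicial (induced Δ W) v
  chordal⇒simplicial (L , chordal) W (x , x∈W) W⊆V =
    -- The search runs over labels, which form a `Fin`, with `W` pulled back along the inverse
    -- labeling.
    let m , m∈W , max = maximum (λ i → proj₁ (vertex i) ∈? W) (label x′ , vertex∘label∈ x′ x∈W)
        v∈ = vertices-induced⊇ W⊆V m∈W
    in (proj₁ (vertex m) , v∈) ,
       maxLabel-simplicial (L , chordal)
         (λ w w∈W → subst (label w Fin.≤_) (sym (label∘vertex m)) (max (label w) (vertex∘label∈ w w∈W)))
         v∈
    where
    open Bijection L using (injective; strictlySurjective) renaming (to to label)

    x′ : Vertex Δ
    x′ = x , W⊆V x∈W

    vertex : Fin _ → Vertex Δ
    vertex = proj₁ ∘ strictlySurjective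

    label∘vertex : ∀ i → label (vertex i) ≡ i
    label∘vertex = proj₂ ∘ strictlySurjective

    vertex∘label∈ : ∀ w → proj₁ w ∈ W → proj₁ (vertex (label w)) ∈ W
    -- Surjectivity makes `vertex` a right inverse of `label`; injectivity makes it a left inverse
    -- too.
    vertex∘label∈ w = subst (λ u → proj₁ u ∈ W) (sym (injective (label∘vertex (label w))))

  -- The maximum is recorded by the element attaining it, which can be compared with the vertex
  -- being removed. Ranks are naturals, so their type does not change as `W` shrinks.
  IsTop : (Fin N → ℕ) → Subset N → Fin N → Set
  IsTop rank f x = x ∈ f × (∀ {y} → y ∈ f → rank y ≤ rank x)

  -- A labeling of W by 0, …, k − 1, with junk values outside W.
  record ChordalRanking (W : Subset N) (k : ℕ) : Set where
    field
      rank       : Fin N → ℕ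
      rank<      : ∀ {x} → x ∈ W → rank x < k
      injective  : ∀ {x y} → x ∈ W → y ∈ W → rank x ≡ rank y → x ≡ y
      surjective : ∀ {i} → i < k → ∃[ x ] x ∈ W × rank x ≡ i
      chordal    : ∀ {f g x} → Face Δ f → Face Δ g → f ⊆ W → g ⊆ W →
                   f ≢ g → ∣ f ∣ ≡ ∣ g ∣ → IsTop rank f x → IsTop rank g x →
                   ∀ h → h ⊆ f ∪ g → ∣ h ∣ ≡ ∣ f ∣ → Face Δ h

  open ChordalRanking

  empty-ranking : ∀ {W} → Empty W → ChordalRanking W 0
  empty-ranking em .rank                            = const 0
  empty-ranking em .rank< x∈W                       = contradiction (_ , x∈W) em
  empty-ranking em .injective x∈W                   = contradiction (_ , x∈W) em
  empty-ranking em .surjective ()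
  empty-ranking em .chordal _ _ f⊆W _ _ _ (x∈f , _) = contradiction (_ , f⊆W x∈f) em

  -- Ranks on `W - v` lie below `k`, so giving `v` the rank `k` makes it the top of every face in
  -- `W` that contains it.
  extend-ranking : ∀ {W k} ((v , v∈) : Vertex (induced Δ W)) →
                   SkeletonESimplicial (induced Δ W) (v , v∈) →
                   ChordalRanking (W - v) k → ChordalRanking W (suc k)
  extend-ranking {W} {k} (v , v∈) simplicial R = record
    { rank       = rank′
    ; rank<      = rank′<
    ; injective  = injective′
    ; surjective = surjective′
    ; chordal    = chordal′
    }
    where
    rank′ : Fin N → ℕ
    rank′ = updateAt (rank R) v (const k)

    v∈W : v ∈ W
    v∈W = vertices-induced⊆ v∈

    rank′-v : rank′ v ≡ k
    rank′-v = updateAt-updates v (rank R)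

    rank′-≢ : ∀ {x} → x ≢ v → rank′ x ≡ rank R x
    rank′-≢ {x} x≢v = updateAt-minimal x v (rank R) x≢v

    rank′<k : ∀ {x} → x ∈ W → x ≢ v → rank′ x < k
    rank′<k x∈W x≢v = subst (_< k) (sym (rank′-≢ x≢v)) (rank< R (x∈p∧x≢y⇒x∈p-y x∈W x≢v))

    rank′< : ∀ {x} → x ∈ W → rank′ x < suc k
    rank′< {x} x∈W with x ≟ v
    ... | yes refl = s≤s (ℕ.≤-reflexive rank′-v)
    ... | no  x≢v  = ℕ.m<n⇒m<1+n (rank′<k x∈W x≢v)

    injective′ : ∀ {x y} → x ∈ W → y ∈ W → rank′ x ≡ rank′ y → x ≡ y
    injective′ {x} {y} x∈W y∈W eq with x ≟ v | y ≟ v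
    ... | yes refl | yes refl = refl
    ... | yes refl | no  y≢v  = contradiction (trans (sym eq) rank′-v) (ℕ.<⇒≢ (rank′<k y∈W y≢v))
    ... | no  x≢v  | yes refl = contradiction (trans eq rank′-v) (ℕ.<⇒≢ (rank′<k x∈W x≢v))
    ... | no  x≢v  | no  y≢v  = injective R
      (x∈p∧x≢y⇒x∈p-y x∈W x≢v) (x∈p∧x≢y⇒x∈p-y y∈W y≢v)
      (trans (sym (rank′-≢ x≢v)) (trans eq (rank′-≢ y≢v)))

    surjective′ : ∀ {i} → i < suc k → ∃[ x ] x ∈ W × rank′ x ≡ i
    surjective′ {i} i<1+k with i ℕ.≟ k
    ... | yes refl = v , v∈W , rank′-v
    ... | no  i≢k  =
      let x , x∈W-v , eq = surjective R (ℕ.≤∧≢⇒< (s≤s⁻¹ i<1+k) i≢k)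
          x≢v            = x∈p-y⇒x≢y W x∈W-v
      in x , p─q⊆p W ⁅ v ⁆ x∈W-v , trans (rank′-≢ x≢v) eq

    chordal′ : ∀ {f g x} → Face Δ f → Face Δ g → f ⊆ W → g ⊆ W →
               f ≢ g → ∣ f ∣ ≡ ∣ g ∣ → IsTop rank′ f x → IsTop rank′ g x →
               ∀ h → h ⊆ f ∪ g → ∣ h ∣ ≡ ∣ f ∣ → Face Δ h
    -- If the common top is `v`, both faces contain `v` and simpliciality applies. Otherwise neither
    -- contains `v`, and the old ranking decides.
    chordal′ {f} {g} {x} f∈Δ g∈Δ f⊆W g⊆W f≢g ∣f∣≡∣g∣ topf topg h h⊆ ∣h∣≡∣f∣ with x ≟ v
    ... | yes refl = proj₁ (simplicial f g (f∈Δ , f⊆W) (g∈Δ , g⊆W) f≢g ∣f∣≡∣g∣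
                              (proj₁ topf) (proj₁ topg) h h⊆ ∣h∣≡∣f∣)
    ... | no x≢v = chordal R f∈Δ g∈Δ (⊆W-v f⊆W topf) (⊆W-v g⊆W topg) f≢g ∣f∣≡∣g∣
                     (top f⊆W topf) (top g⊆W topg) h h⊆ ∣h∣≡∣f∣
      where
      -- If `v` were in `e`, its rank `k` would be bounded by the rank of the top `x`, which is
      -- below `k` since `x` differs from `v`.
      ≢v : ∀ {e y} → e ⊆ W → IsTop rank′ e x → y ∈ e → y ≢ v
      ≢v e⊆W (x∈e , max) v∈e refl =
        ℕ.<⇒≱ (rank′<k (e⊆W x∈e) x≢v) (subst (_≤ rank′ x) rank′-v (max v∈e))

      ⊆W-v : ∀ {e} → e ⊆ W → IsTop rank′ e x → e ⊆ W - v
      ⊆W-v e⊆W tope y∈e = x∈p∧x≢y⇒x∈p-y (e⊆W y∈e) (≢v e⊆W tope y∈e)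

      top : ∀ {e} → e ⊆ W → IsTop rank′ e x → IsTop (rank R) e x
      top e⊆W tope@(x∈e , max) = x∈e , λ y∈e →
        -- The two rankings agree away from `v`, and `e` avoids `v`.
        subst₂ _≤_ (rank′-≢ (≢v e⊆W tope y∈e)) (rank′-≢ x≢v) (max y∈e)

  ranking⇒chordal : ChordalRanking (vertices Δ) ∣ vertices Δ ∣ → SkeletonEChordal Δ
  ranking⇒chordal R = mk⤖ ((λ {v} {w} → inj v w) , surj) ,
    λ { f g f∈Δ g∈Δ f≢g ∣f∣≡∣g∣ (_ , ((v , v∈f , refl) , maxf) , ((w , w∈g , eq) , maxg)) →
        chordal R f∈Δ g∈Δ (Face⇒⊆vertices f∈Δ) (Face⇒⊆vertices g∈Δ) f≢g ∣f∣≡∣g∣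
          (v∈f , top v f∈Δ maxf)
          -- The maximal label is attained at `v` in `f` and at `w` in `g`; injectivity identifies
          -- the two, giving a common top.
          (subst (_∈ g) (cong proj₁ (inj w v eq)) w∈g , top v g∈Δ maxg) }
    where
    label : Vertex Δ → Fin ∣ vertices Δ ∣
    label (_ , x∈V) = fromℕ< (rank< R x∈V)

    toℕ-label : ∀ v → toℕ (label v) ≡ rank R (proj₁ v)
    toℕ-label (_ , x∈V) = toℕ-fromℕ< (rank< R x∈V)

    -- Ranks see only the underlying element, whereas a labeling must be injective on elements
    -- paired with membership proofs.
    Vertex-≡ : ∀ {v w : Vertex Δ} → proj₁ v ≡ proj₁ w → v ≡ w
    Vertex-≡ {_ , p} {_ , q} refl = cong (_ ,_) ([]=-irrelevant p q)

    inj : ∀ v w → label v ≡ label w → v ≡ w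
    inj v w eq = Vertex-≡ (injective R (proj₂ v) (proj₂ w)
      (trans (sym (toℕ-label v)) (trans (cong toℕ eq) (toℕ-label w))))

    surj : ∀ i → ∃[ v ] (∀ {w} → w ≡ v → label w ≡ i)
    surj i = let x , x∈V , eq = surjective R (toℕ<n i) in
      (x , x∈V) , λ { refl → toℕ-injective (trans (toℕ-label (x , x∈V)) eq) }

    top : ∀ v {e} → Face Δ e → (∀ w → proj₁ w ∈ e → label w Fin.≤ label v) →
          ∀ {y} → y ∈ e → rank R y ≤ rank R (proj₁ v)
    top v e∈Δ max {y} y∈e = subst₂ _≤_ (toℕ-label w) (toℕ-label v) (max w y∈e)
      where
      w : Vertex Δ
      w = y , Face⇒⊆vertices e∈Δ y∈e

  -- Induction on the cardinality of `W`. The hypothesis is applied afresh to each remaining vertex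
  -- set, and the vertex removed first receives the largest rank.
  simplicial⇒ranking :
    (∀ W → Nonempty W → W ⊆ vertices Δ → ∃[ v ] SkeletonESimplicial (induced Δ W) v) →
    ∀ k W → W ⊆ vertices Δ → ∣ W ∣ ≡ k → ChordalRanking W k
  simplicial⇒ranking _ zero W _ ∣W∣≡0 = empty-ranking (∣p∣≡0⇒Empty ∣W∣≡0)
  simplicial⇒ranking simplicial (suc k) W W⊆V ∣W∣≡1+k =
    let v , v-simplicial = simplicial W (∣p∣≡1+k⇒Nonempty ∣W∣≡1+k) W⊆V
        v∈W = vertices-induced⊆ (proj₂ v)
    in extend-ranking v v-simplicial
         (simplicial⇒ranking simplicial k (W - proj₁ v) (W⊆V ∘ p─q⊆p W ⁅ proj₁ v ⁆)
           (ℕ.suc-injective (trans (sym (∣p∣≡1+∣p-x∣ v∈W)) ∣W∣≡1+k)))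

theorem3 : ∀ (N : ℕ) (Δ : SimplicialComplex N) →
    SkeletonEChordal Δ ⇔
    (∀ (W : Subset N) → Nonempty W → W ⊆ vertices Δ →
    ∃[ v ] SkeletonESimplicial (induced Δ W) v)
theorem3 N Δ = mk⇔ (chordal⇒simplicial Δ)
  λ simplicial → ranking⇒chordal Δ
    (simplicial⇒ranking Δ simplicial ∣ vertices Δ ∣ (vertices Δ) (λ x∈V → x∈V) refl)
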